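{- Let $G$ be a median graph with basepoint $v_0$, let $u,v\in V$ with $u\in I(v_0,v)$, let $L$ be a POF outgoing from $v$, and let $w$ be the anti-basis of the hypercube with basis $v$ and signature $L$. The following are equivalent: (i) $\overline{\pi}(u,w)=v$; (ii) $\Pi(u,w)=\Pi(u,v)\cup\{w\}$; (iii) for every class $E_i\in L$, the set $\overline{L}_{u,v}\cup\{E_i\}$ is not a POF.
   Context: $G=(V,E)$ is a finite, connected, undirected median graph (every triple $x,y,z$ has exactly one vertex in $I(x,y)\cap I(y,z)\cap I(z,x)$, with $I(x,y)=\{w: d(x,w)+d(w,y)=d(x,y)\}$). $\Theta$-classes are the classes of the reflexive transitive closure of the relation "$xy$ and $x'y'$ are opposite edges of a 4-cycle"; each class splits $G$ into two halfspaces. Classes $E_i,E_j$ are orthogonal if some 4-cycle $abcd$ has $ab,cd\in E_i$ and $bc,da\in E_j$; a POF is a set of pairwise orthogonal classes. Edges are oriented away from the fixed basepoint $v_0$; a POF $L$ is outgoing from $x$ if each class of $L$ has an edge oriented out of $x$, and then the hypercube with basis $x$ and signature $L$ is the unique induced hypercube whose vertex closest to $v_0$ (basis) is $x$ and whose edges have exactly the classes of $L$; its anti-basis is its vertex farthest from $v_0$. For $x\in I(v_0,y)$, the ladder set $L_{x,y}$ is the set of classes separating $x$ and $y$ that have an edge incident to $x$ (it is a POF outgoing from $x$). Milestones: for $x\in I(v_0,y)$, let $x^+$ be the anti-basis of the hypercube with basis $x$ and signature $L_{x,y}$; if $x^+=y$ then $\Pi(x,y)=\{x,y\}$, otherwise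 $\Pi(x,y)=\{x\}\cup\Pi(x^+,y)$. The penultimate milestone $\overline{\pi}(x,y)$ is the milestone in $\Pi(x,y)$ other than $y$ that is closest to $y$, and $\overline{L}_{x,y}$ is the set of $\Theta$-classes of the hypercube with basis $\overline{\pi}(x,y)$ and anti-basis $y$.
   Formalization: The formal theorem assumes u ≠ v, since the penultimate milestone of (v,v), hence the set in (iii), is undefined, and L nonempty, since for L = ∅ one has w = v, so (i) fails while (ii) and (iii) hold. -}

module Defs where

open import Data.Nat using (ℕ; zero; suc; _+_; _≤_)
open import Data.Bool using (Bool)
open import Data.Fin using (Fin)
open import Data.Vec using (lookup)
open import Data.Fin.Subset using (Subset)
open import Data.Product using (Σ; ∃; _×_; _,_; proj₁; proj₂)
open import Data.Sum using (_⊎_)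
open import Data.List using (List; []; _∷_)
open import Data.List.Membership.Propositional using (_∈_)
open import Relation.Binary.PropositionalEquality using (_≡_; _≢_)
open import Relation.Binary.Construct.Closure.ReflexiveTransitive using (Star)
open import Relation.Nullary using (¬_)

data Walk {V : Set} (R : V → V → Set) : V → V → ℕ → Set where
  []  : ∀ {x} → Walk R x x 0
  _∷_ : ∀ {x y z n} → R x y → Walk R y z n → Walk R x z (suc n)

-- Finite connected median graphs.
-- `d` is the graph metric: it is uniquely determined by the adjacency
-- relation through `d-walk` and `d-min` (and `d-walk` gives connectivity).

record MedianGraph : Set₁ where
  field
    V        : Set
    _~_      : V → V → Set
    ~-sym    : ∀ {x y} → x ~ y → y ~ x
    ~-irrefl : ∀ {x} → ¬ (x ~ x)
    finite   : Σ (List V) λ vs → ∀ x → x ∈ vs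
    d        : V → V → ℕ
    d-walk   : ∀ x y → Walk _~_ x y (d x y)
    d-min    : ∀ {x y n} → Walk _~_ x y n → d x y ≤ n

  I : V → V → V → Set
  I x y w = d x w + d w y ≡ d x y

  field
    median : ∀ x y z → Σ V λ m → (I x y m × I y z m × I z x m)
                         × (∀ m' → I x y m' × I y z m' × I z x m' → m ≡ m')

module Theory (G : MedianGraph) (v0 : MedianGraph.V G) where
  open MedianGraph G public

  Pair : Set
  Pair = V × V

  IsEdge : Pair → Set
  IsEdge (a , b) = a ~ b

  Square : V → V → V → V → Set
  Square a b c d = a ~ b × b ~ c × c ~ d × d ~ a × a ≢ c × b ≢ d

  SameEdge : Pair → Pair → Set
  SameEdge (a , b) (a' , b') = (a ≡ a' × b ≡ b') ⊎ (a ≡ b' × b ≡ a')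

  Opposite : Pair → Pair → Set
  Opposite (x , y) (x' , y') = Square x y y' x' ⊎ Square x y x' y'

  -- Θ: reflexive-transitive closure of "opposite in a 4-cycle"
  -- (on undirected edges, hence SameEdge is included)
  Θ : Pair → Pair → Set
  Θ = Star (λ e f → Opposite e f ⊎ SameEdge e f)

  -- sets of Θ-classes: predicates on pairs that contain only edges and are Θ-closed
  ClassSet : Set₁
  ClassSet = Pair → Set

  IsClassSet : ClassSet → Set
  IsClassSet S = (∀ e → S e → IsEdge e) × (∀ e f → Θ e f → S e → S f)

  Orth : Pair → Pair → Set
  Orth e f = Σ V λ a → Σ V λ b → Σ V λ c → Σ V λ dd →
             Square a b c dd × Θ (a , b) e × Θ (c , dd) e × Θ (b , c) f × Θ (dd , a) f

  POF : ClassSet → Set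
  POF S = ∀ e f → S e → S f → ¬ Θ e f → Orth e f

  OutgoingFrom : V → ClassSet → Set
  OutgoingFrom x S = ∀ e → S e → Σ V λ z → x ~ z × d v0 z ≡ suc (d v0 x) × Θ (x , z) e

  Separates : Pair → V → V → Set
  Separates e x y = ∀ n → ¬ Walk (λ a b → a ~ b × ¬ Θ (a , b) e) x y n

  QAdj : ∀ {k} → Subset k → Subset k → Set
  QAdj {k} A B = Σ (Fin k) λ i → lookup A i ≢ lookup B i ×
                   (∀ j → j ≢ i → lookup A j ≡ lookup B j)

  record HCube : Set where
    field
      k     : ℕ
      f     : Subset k → V
      f-inj : ∀ A B → f A ≡ f B → A ≡ B
      f-adj : ∀ A B → (f A ~ f B → QAdj A B) × (QAdj A B → f A ~ f B)
  open HCube public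

  IsVertexOf : HCube → V → Set
  IsVertexOf c z = Σ (Subset (k c)) λ A → f c A ≡ z

  HasBasis : HCube → V → Set
  HasBasis c x = IsVertexOf c x × (∀ B → d v0 x ≤ d v0 (f c B))

  HasAntiBasis : HCube → V → Set
  HasAntiBasis c w = IsVertexOf c w × (∀ B → d v0 (f c B) ≤ d v0 w)

  ClassesOf : HCube → ClassSet
  ClassesOf c e = Σ (Subset (k c)) λ A → Σ (Subset (k c)) λ B →
                    QAdj A B × Θ (f c A , f c B) e

  HasSignature : HCube → ClassSet → Set
  HasSignature c S = (∀ A B → QAdj A B → S (f c A , f c B)) ×
                     (∀ e → S e → ClassesOf c e)

  AntiBasisOf : V → ClassSet → V → Set
  AntiBasisOf x S w = Σ HCube λ c → HasBasis c x × HasSignature c S × HasAntiBasis c w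

  Ladder : V → V → ClassSet
  Ladder x y e = IsEdge e × Separates e x y × Σ V λ z → x ~ z × Θ (x , z) e

  -- Milestones x y ms : ms lists the milestones Π(x,y) (as a list, read as a set)
  data Milestones : V → V → List V → Set where
    done : ∀ {x y} → I v0 y x → AntiBasisOf x (Ladder x y) y →
           Milestones x y (x ∷ y ∷ [])
    step : ∀ {x x⁺ y ms} → I v0 y x → AntiBasisOf x (Ladder x y) x⁺ → x⁺ ≢ y →
           Milestones x⁺ y ms → Milestones x y (x ∷ ms)

  Penultimate : V → V → V → Set
  Penultimate x y p = Σ (List V) λ ms → Milestones x y ms × p ∈ ms × p ≢ y ×
                        (∀ q → q ∈ ms → q ≢ y → d p y ≤ d q y)

  LBar : V → V → ClassSet
  LBar x y e = Σ V λ p → Penultimate x y p ×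
                 Σ HCube λ c → HasBasis c p × HasAntiBasis c y × ClassesOf c e

module Submission where

-- A class e separates x and y iff x and y are on different sides of each edge of e, so a vertex is known
-- from its sides, and medians, intervals, adjacency and hypercubes can all be read off from them: the
-- classes of a hypercube are exactly those separating its basis from its anti-basis.
-- Let p be the penultimate milestone of (u,v). If some e ∈ L is orthogonal to every class separating p
-- from v, squares carry an e-edge at v along a geodesic down to p; then e is in the ladder set of (p,w)
-- and the milestone of (u,w) after p is not v. Conversely, if the ladder sets of (x,v) and (x,w) differ at
-- some milestone x of (u,v), a class e ∈ L has an edge at x, hence at every vertex of I(x,v) and at p, and
-- then L̄(u,v) ∪ {e} is a POF. So (iii) holds iff (u,v) and (u,w) share their ladder sets up to v.

open import Defs
open import Data.Bool using (Bool; true; false; not)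
import Data.Bool.Properties as Bool
open import Data.Fin using (Fin; zero; suc)
import Data.Fin.Properties as Fin
open import Data.Fin.Subset using (Subset; ⊤) renaming (⊥ to ∅)
open import Data.List using (List; []; _∷_; length; filter; deduplicate)
import Data.List as List
open import Data.List.Membership.Propositional using (_∈_)
open import Data.List.Membership.Propositional.Properties
  using (∈-filter⁺; ∈-filter⁻; ∈-deduplicate⁺; ∈-deduplicate⁻; ∈-lookup)
import Data.List.Relation.Unary.All as All
open import Data.List.Relation.Unary.AllPairs using (_∷_)
open import Data.List.Relation.Unary.Any using (here; there; index)
open import Data.List.Relation.Unary.Any.Properties using (lookup-index)
open import Data.List.Relation.Unary.Unique.DecPropositional.Properties using (deduplicate-!)
open import Data.List.Relation.Unary.Unique.Propositional using (Unique)
open import Data.Nat using (ℕ; zero; suc; _+_; _≤_; _<_; _<?_; s≤s)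
open import Data.Nat.Properties
  using (≤-refl; ≤-reflexive; ≤-trans; ≤-antisym; ≤-pred; <⇒≤; <⇒≱; ≤∧≢⇒<; ≤-<-trans; n≤0⇒n≡0; n≤1+n;
         1+n≰n; 0≢1+n; suc-injective; +-comm; +-suc; +-cancelˡ-≡; +-cancelʳ-≡; m≤m+n; m≤n+m; module ≤-Reasoning)
  renaming (_≟_ to _≟ℕ_)
open import Data.Product using (Σ; _×_; _,_; proj₁; proj₂)
open import Data.Sum using (_⊎_; inj₁; inj₂; [_,_]′; map₁)
open import Data.Vec using ([]; _∷_; lookup; updateAt)
open import Data.Vec.Properties
  using (lookup∘updateAt; lookup∘updateAt′; updateAt-updateAt; updateAt-id-local; updateAt-commutes;
         tabulate∘lookup; tabulate-cong; lookup-replicate)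
open import Function using (_∘_; case_of_)
open import Function.Bundles using (_⇔_; mk⇔; Equivalence)
open import Relation.Binary.Construct.Closure.ReflexiveTransitive using (ε; _◅_; _◅◅_; reverse)
open import Relation.Binary.PropositionalEquality
  using (_≡_; _≢_; refl; sym; trans; cong; cong₂; subst; subst₂; module ≡-Reasoning)
open import Relation.Nullary using (¬_; Dec; yes; no; does; contradiction)
open import Relation.Nullary.Decidable using (dec-true; dec-false; map′; _×-dec_)

open Equivalence using (to; from)

≢∧≢⇒≡ : {a b c : Bool} → a ≢ b → b ≢ c → a ≡ c
≢∧≢⇒≡ {b = b} a≢b b≢c = trans (Bool.¬-not a≢b) (sym (Bool.¬-not (b≢c ∘ sym)))

lookup-injective : ∀ {A : Set} {xs : List A} → Unique xs → ∀ {i j} →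
                   List.lookup xs i ≡ List.lookup xs j → i ≡ j
lookup-injective (_ ∷ _) {zero} {zero} _ = refl
lookup-injective {xs = _ ∷ xs} (h ∷ _) {zero} {suc j} eq =
  contradiction eq (All.lookup h (∈-lookup {xs = xs} j))
lookup-injective {xs = _ ∷ xs} (h ∷ _) {suc i} {zero} eq =
  contradiction (sym eq) (All.lookup h (∈-lookup {xs = xs} i))
lookup-injective (_ ∷ u) {suc i} {suc j} eq = cong suc (lookup-injective u eq)

module MedianTheory (G : MedianGraph) (v0 : MedianGraph.V G) where
  open Theory G v0

  -- The graph metric.

  _++ʷ_ : ∀ {R : V → V → Set} {x y z m n} → Walk R x y m → Walk R y z n → Walk R x z (m + n)
  []      ++ʷ w′ = w′
  (r ∷ w) ++ʷ w′ = r ∷ (w ++ʷ w′)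

  reverseʷ : ∀ {x y n} → Walk _~_ x y n → Walk _~_ y x n
  reverseʷ [] = []
  reverseʷ {n = suc n} (r ∷ w) =
    subst (Walk _~_ _ _) (+-comm n 1) (reverseʷ w ++ʷ (~-sym r ∷ []))

  d-sym : ∀ x y → d x y ≡ d y x
  d-sym x y = ≤-antisym (d-min (reverseʷ (d-walk y x))) (d-min (reverseʷ (d-walk x y)))

  d-triangle : ∀ x y z → d x z ≤ d x y + d y z
  d-triangle x y z = d-min (d-walk x y ++ʷ d-walk y z)

  d-refl : ∀ x → d x x ≡ 0
  d-refl x = n≤0⇒n≡0 (d-min [])

  d≡0⇒≡ : ∀ {x y} → d x y ≡ 0 → x ≡ y
  d≡0⇒≡ {x} {y} eq with d x y | d-walk x y
  d≡0⇒≡ refl | _ | [] = refl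

  d≡1⇒~ : ∀ {x y} → d x y ≡ 1 → x ~ y
  d≡1⇒~ {x} {y} eq with d x y | d-walk x y
  d≡1⇒~ refl | _ | r ∷ [] = r

  _≟_ : (x y : V) → Dec (x ≡ y)
  x ≟ y = map′ d≡0⇒≡ (λ { refl → d-refl x }) (d x y ≟ℕ 0)

  ~⇒≢ : ∀ {x y} → x ~ y → x ≢ y
  ~⇒≢ r refl = ~-irrefl r

  ~⇒d≡1 : ∀ {x y} → x ~ y → d x y ≡ 1
  ~⇒d≡1 {x} {y} r with d x y in eq | d-min (r ∷ [])
  ... | 0 | _ = contradiction (d≡0⇒≡ eq) (~⇒≢ r)
  ... | 1 | _ = refl
  ... | suc (suc _) | s≤s ()

  d-lipschitz : ∀ {a b} x → a ~ b → d x b ≤ suc (d x a)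
  d-lipschitz {a} {b} x r = begin
    d x b           ≤⟨ d-triangle x a b ⟩
    d x a + d a b   ≡⟨ cong (d x a +_) (~⇒d≡1 r) ⟩
    d x a + 1       ≡⟨ +-comm _ 1 ⟩
    suc (d x a)     ∎
    where open ≤-Reasoning

  d-lipschitzˡ : ∀ {a b} x → a ~ b → d a x ≤ suc (d b x)
  d-lipschitzˡ {a} {b} x r = subst₂ (λ m n → m ≤ suc n) (d-sym x a) (d-sym x b) (d-lipschitz x (~-sym r))

  -- Intervals, bipartiteness and the quadrangle condition.

  I-sym : ∀ {x y m} → I x y m → I y x m
  I-sym {x} {y} {m} i = begin
    d y m + d m x   ≡⟨ cong₂ _+_ (d-sym y m) (d-sym m x) ⟩
    d m y + d x m   ≡⟨ +-comm (d m y) _ ⟩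
    d x m + d m y   ≡⟨ i ⟩
    d x y           ≡⟨ d-sym x y ⟩
    d y x           ∎
    where open ≡-Reasoning

  I⇒≤ : ∀ {a b m} → I a b m → d a m ≤ d a b
  I⇒≤ {a} {b} {m} i = subst (d a m ≤_) i (m≤m+n _ _)

  I⇒≤ʳ : ∀ {a b m} → I a b m → d m b ≤ d a b
  I⇒≤ʳ {a} {b} {m} i = subst (d m b ≤_) i (m≤n+m _ _)

  I-left : ∀ {x y} → I x y x
  I-left {x} {y} = cong (_+ d x y) (d-refl x)

  I-right : ∀ {x y} → I x y y
  I-right = I-sym I-left

  -- A median graph is bipartite.
  edge-cases : ∀ {a b} → a ~ b → ∀ x → d x b ≡ suc (d x a) ⊎ d x a ≡ suc (d x b)
  edge-cases {a} {b} r x with median x a b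
  ... | m , (xam , abm , bxm) , _ with d a m in eq | trans abm (~⇒d≡1 r)
  ... | 0 | _ rewrite d≡0⇒≡ eq = inj₁ (begin
        d x b           ≡⟨ d-sym x b ⟩
        d b x           ≡⟨ bxm ⟨
        d b m + d m x   ≡⟨ cong₂ _+_ (~⇒d≡1 (subst (b ~_) (d≡0⇒≡ eq) (~-sym r))) (d-sym m x) ⟩
        suc (d x m)     ∎)
    where open ≡-Reasoning
  ... | 1 | eq′ rewrite d≡0⇒≡ (suc-injective eq′) = inj₂ (begin
        d x a           ≡⟨ xam ⟨
        d x b + d b a   ≡⟨ cong (d x b +_) (~⇒d≡1 (~-sym r)) ⟩
        d x b + 1       ≡⟨ +-comm _ 1 ⟩
        suc (d x b)     ∎)
    where open ≡-Reasoning
  ... | suc (suc _) | ()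

  step-towards : ∀ {x y} → x ≢ y → Σ V λ z → x ~ z × d x y ≡ suc (d z y)
  step-towards {x} {y} x≢y with d x y in eq | d-walk x y
  ... | _ | [] = contradiction refl x≢y
  ... | suc n | _∷_ {y = z} r w =
    z , r , ≤-antisym (subst (_≤ suc (d z y)) eq (d-lipschitzˡ y r)) (s≤s (d-min w))

  I-step : ∀ {x y z m} → x ~ z → d x m ≡ suc (d z m) → I x y m → I z y m × d x y ≡ suc (d z y)
  I-step {x} {y} {z} {m} r eq i = zym , trans xy (cong suc zym)
    where
    xy : d x y ≡ suc (d z m + d m y)
    xy = trans (sym i) (cong (_+ d m y) eq)
    zym : I z y m
    zym = ≤-antisym (≤-pred (≤-trans (≤-reflexive (sym xy)) (d-lipschitzˡ y r))) (d-triangle z m y)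

  -- The fourth corner is the median of p, q and y. It is equally far from p and q, and since 0 <
  -- d(p,q) ≤ 2 that common distance is 1.
  quadrangle : ∀ {x y p q} → x ~ p → x ~ q → p ≢ q → d x y ≡ suc (d p y) → d x y ≡ suc (d q y) →
               Σ V λ m → Square x p m q × d p y ≡ suc (d m y)
  quadrangle {x} {y} {p} {q} xp xq p≢q ep eq with median p q y
  ... | m , (pqm , qym , ypm) , _ =
    m , (xp , d≡1⇒~ pm≡1 , ~-sym (d≡1⇒~ (trans (sym pm≡qm) pm≡1)) , ~-sym xq , x≢m , p≢q) , py
    where
    pym : d p m + d m y ≡ d p y
    pym = I-sym ypm
    pm≡qm : d p m ≡ d q m
    pm≡qm = +-cancelˡ-≡ (d m y) _ _ (begin
      d m y + d p m   ≡⟨ +-comm (d m y) _ ⟩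
      d p m + d m y   ≡⟨ pym ⟩
      d p y           ≡⟨ suc-injective (trans (sym ep) eq) ⟩
      d q y           ≡⟨ qym ⟨
      d q m + d m y   ≡⟨ +-comm (d q m) _ ⟩
      d m y + d q m   ∎)
      where open ≡-Reasoning
    pq≡ : d p m + d p m ≡ d p q
    pq≡ = trans (cong (d p m +_) (trans pm≡qm (d-sym q m))) pqm
    half : ∀ n → n + n ≤ 2 → n ≢ 0 → n ≡ 1
    half 0 _ n≢0 = contradiction refl n≢0
    half 1 _ _ = refl
    half (suc (suc n)) (s≤s (s≤s h)) _ with () ← subst (_≤ 0) (+-suc n (suc n)) h
    pm≡1 : d p m ≡ 1
    pm≡1 = half (d p m) (≤-trans (≤-reflexive pq≡) (d-min (~-sym xp ∷ (xq ∷ []))))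
      λ z → p≢q (trans (d≡0⇒≡ z) (sym (d≡0⇒≡ (trans (sym pm≡qm) z))))
    py : d p y ≡ suc (d m y)
    py = trans (sym pym) (cong (_+ d m y) pm≡1)
    x≢m : x ≢ m
    x≢m refl = 1+n≰n (≤-trans (n≤1+n _) (≤-reflexive (sym (trans ep (cong suc py)))))

  -- Halfspaces of an edge.

  -- For an edge ab, the value true marks the halfspace of a.
  side : Pair → V → Bool
  side (a , b) x = does (d x a <? d x b)

  -- Reversing an edge negates `side` everywhere, so comparing two sides gives a relation that does
  -- not depend on the orientation.
  Sep : Pair → V → V → Set
  Sep e x y = side e x ≢ side e y

  Same : Pair → V → V → Set
  Same e x y = side e x ≡ side e y

  same? : ∀ e x y → Dec (Same e x y)
  same? e x y = side e x Bool.≟ side e y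

  side-near : ∀ {a b x} → d x b ≡ suc (d x a) → side (a , b) x ≡ true
  side-near eq = dec-true (_ <? _) (≤-reflexive (sym eq))

  side-far : ∀ {a b x} → d x a ≡ suc (d x b) → side (a , b) x ≡ false
  side-far eq = dec-false (_ <? _) λ lt → <⇒≱ lt (≤-trans (n≤1+n _) (≤-reflexive (sym eq)))

  side-swap : ∀ {a b} → a ~ b → ∀ x → side (b , a) x ≡ not (side (a , b) x)
  side-swap r x with edge-cases r x
  ... | inj₁ eq = trans (side-far eq) (cong not (sym (side-near eq)))
  ... | inj₂ eq = trans (side-near eq) (cong not (sym (side-far eq)))

  -- Otherwise both a and c would be medians of b, d′ and x.
  square-near : ∀ {a b c d′} x → Square a b c d′ → d x b ≡ suc (d x a) → ¬ d x d′ ≡ suc (d x c)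
  square-near {a} {b} {c} {d′} x (ab , bc , cd , da , a≢c , b≢d) eb ed with edge-cases bc x
  ... | inj₁ ec = 1+n≰n (begin
      suc (suc (d x a))         ≤⟨ n≤1+n _ ⟩
      suc (suc (suc (d x a)))   ≡⟨ cong (2 +_) eb ⟨
      suc (suc (d x b))         ≡⟨ cong suc ec ⟨
      suc (d x c)               ≡⟨ ed ⟨
      d x d′                    ≤⟨ d-lipschitz x (~-sym da) ⟩
      suc (d x a)               ∎)
    where open ≤-Reasoning
  ... | inj₂ eb′ with median b d′ x
  ... | m , _ , uniq = a≢c (trans (sym (uniq a (mid ab da eb (trans ed (cong suc (sym a≡c))))))
                                  (uniq c (mid (~-sym bc) (~-sym cd) eb′ ed)))
    where
    a≡c : d x a ≡ d x c
    a≡c = suc-injective (trans (sym eb) eb′)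
    bd≡2 : d b d′ ≡ 2
    bd≡2 with edge-cases da b
    ... | inj₁ e = contradiction (d≡0⇒≡ (suc-injective (trans (sym e) (~⇒d≡1 (~-sym ab))))) b≢d
    ... | inj₂ e = trans e (cong suc (~⇒d≡1 (~-sym ab)))
    mid : ∀ {t} → t ~ b → d′ ~ t → d x b ≡ suc (d x t) → d x d′ ≡ suc (d x t) →
          I b d′ t × I d′ x t × I x b t
    mid {t} tb dt e e′ =
        trans (cong₂ _+_ (~⇒d≡1 (~-sym tb)) (~⇒d≡1 (~-sym dt))) (sym bd≡2)
      , trans (cong₂ _+_ (~⇒d≡1 dt) (d-sym t x)) (trans (sym e′) (d-sym x d′))
      , trans (cong (d x t +_) (~⇒d≡1 tb)) (trans (+-comm _ 1) (sym e))

  -- Bipartiteness leaves two mixed cases; `square-near` excludes one for the square itself and the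
  -- other for its mirror image.
  square-side : ∀ {a b c d′} → Square a b c d′ → ∀ x → side (a , b) x ≡ side (d′ , c) x
  square-side sq@(ab , bc , cd , da , a≢c , b≢d) x with edge-cases ab x | edge-cases (~-sym cd) x
  ... | inj₁ e | inj₁ e′ = trans (side-near e) (sym (side-near e′))
  ... | inj₁ e | inj₂ e′ = contradiction e′ (square-near x sq e)
  ... | inj₂ e | inj₁ e′ = contradiction e′
        (square-near x (~-sym ab , ~-sym da , ~-sym cd , ~-sym bc , b≢d , a≢c) e)
  ... | inj₂ e | inj₂ e′ = trans (side-far e) (sym (side-far e′))

  -- Θ-classes as cuts between two halfspaces.

  Θ-sym : ∀ {e f} → Θ e f → Θ f e
  Θ-sym = reverse λ
    { (inj₁ (inj₁ (ab , bc , cd , da , a≢c , b≢d))) →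
        inj₁ (inj₁ (~-sym cd , ~-sym bc , ~-sym ab , ~-sym da , b≢d ∘ sym , a≢c ∘ sym))
    ; (inj₁ (inj₂ (ab , bc , cd , da , a≢c , b≢d))) → inj₁ (inj₂ (cd , da , ab , bc , a≢c ∘ sym , b≢d ∘ sym))
    ; (inj₂ (inj₁ (refl , refl))) → inj₂ (inj₁ (refl , refl))
    ; (inj₂ (inj₂ (refl , refl))) → inj₂ (inj₂ (refl , refl)) }

  Θ-swap : ∀ {a b} → Θ (a , b) (b , a)
  Θ-swap = inj₂ (inj₂ (refl , refl)) ◅ ε

  Θ-edge : ∀ {e f} → Θ e f → IsEdge e → IsEdge f
  Θ-edge ε ed = ed
  Θ-edge (inj₁ (inj₁ (ab , bc , cd , da , _)) ◅ s) ed = Θ-edge s (~-sym cd)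
  Θ-edge (inj₁ (inj₂ (ab , bc , cd , da , _)) ◅ s) ed = Θ-edge s cd
  Θ-edge (inj₂ (inj₁ (refl , refl)) ◅ s) ed = Θ-edge s ed
  Θ-edge (inj₂ (inj₂ (refl , refl)) ◅ s) ed = Θ-edge s (~-sym ed)

  -- Each generating step of Θ keeps the two halfspaces or interchanges them; being on a common side
  -- survives both.
  Same-Θ : ∀ {e f} → Θ e f → IsEdge e → ∀ {x y} → Same e x y → Same f x y
  Same-Θ ε ed same = same
  Same-Θ (inj₁ (inj₁ sq@(ab , bc , cd , da , _)) ◅ s) ed {x} {y} same =
    Same-Θ s (~-sym cd) (trans (sym (square-side sq x)) (trans same (square-side sq y)))
  Same-Θ (inj₁ (inj₂ sq@(ab , bc , cd , da , _)) ◅ s) ed {x} {y} same =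
    Same-Θ s cd (trans (swapped x) (trans (cong not same) (sym (swapped y))))
    where
    swapped : ∀ t → _ ≡ not _
    swapped t = trans (side-swap (~-sym cd) t) (cong not (sym (square-side sq t)))
  Same-Θ (inj₂ (inj₁ (refl , refl)) ◅ s) ed same = Same-Θ s ed same
  Same-Θ (inj₂ (inj₂ (refl , refl)) ◅ s) ed {x} {y} same =
    Same-Θ s (~-sym ed) (trans (side-swap ed x) (trans (cong not same) (sym (side-swap ed y))))

  Sep-Θ : ∀ {e f} → Θ e f → IsEdge e → ∀ {x y} → Sep e x y → Sep f x y
  Sep-Θ s ed sep same = sep (Same-Θ (Θ-sym s) (Θ-edge s ed) same)

  -- A square on ab and a neighbour of a towards x moves ab one step towards xy.
  crossing-Θ : ∀ n {a b x y} → a ~ b → x ~ y →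
               d a x ≡ n → d b y ≡ n → d a y ≡ suc n → d b x ≡ suc n → Θ (a , b) (x , y)
  crossing-Θ zero ab xy ax by _ _ rewrite d≡0⇒≡ ax | d≡0⇒≡ by = ε
  crossing-Θ (suc n) {a} {b} {x} {y} ab xy ax by ay bx
    with a′ , aa′ , ea ← step-towards {a} {x} (λ { refl → 0≢1+n (trans (sym (d-refl a)) ax) })
    with a′x ← suc-injective (trans (sym ea) ax)
    with a′y ← ≤-antisym (subst (λ k → d a′ y ≤ suc k) a′x (d-lipschitz a′ xy))
                         (≤-pred (subst (_≤ suc (d a′ y)) ay (d-lipschitzˡ y aa′)))
    with m , sq@(_ , bm , ma′ , _) , em ←
      quadrangle ab aa′ (λ { refl → 1+n≰n (≤-trans (n≤1+n _) (≤-reflexive (trans (sym bx) a′x))) })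
        (trans ay (cong suc (sym by))) (trans ay (cong suc (sym a′y)))
    = inj₁ (inj₁ sq) ◅ crossing-Θ n (~-sym ma′) xy a′x (suc-injective (trans (sym em) by)) a′y
        (≤-antisym (subst (λ k → d m x ≤ suc k) a′x (d-lipschitzˡ x ma′))
                   (≤-pred (subst (_≤ suc (d m x)) bx (d-lipschitzˡ x bm))))

  -- Distances change by at most one along xy, which forces d(x,a) = d(y,b), the common length that
  -- `crossing-Θ` requires.
  crossing-near-Θ : ∀ {a b x y} → a ~ b → x ~ y → d x b ≡ suc (d x a) → d y a ≡ suc (d y b) →
                    Θ (a , b) (x , y)
  crossing-near-Θ {a} {b} {x} {y} ab xy ex ey =
    crossing-Θ (d x a) ab xy (d-sym a x) (trans (d-sym b y) (sym eq))
      (trans (d-sym a y) (trans ey (cong suc (sym eq)))) (trans (d-sym b x) ex)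
    where
    eq : d x a ≡ d y b
    eq = ≤-antisym (≤-pred (subst (_≤ suc (d y b)) ex (d-lipschitzˡ b xy)))
                   (≤-pred (subst (_≤ suc (d x a)) ey (d-lipschitzˡ a (~-sym xy))))

  -- Together with `Sep-Θ` this identifies the class of e with the edges whose ends e separates, so
  -- membership in a class can be tested by sides.
  crossing⇒Θ : ∀ {e x y} → IsEdge e → x ~ y → Sep e x y → Θ e (x , y)
  crossing⇒Θ {a , b} {x} {y} ab xy sep with edge-cases ab x | edge-cases ab y
  ... | inj₁ ex | inj₁ ey = contradiction (trans (side-near ex) (sym (side-near ey))) sep
  ... | inj₂ ex | inj₂ ey = contradiction (trans (side-far ex) (sym (side-far ey))) sep
  ... | inj₁ ex | inj₂ ey = crossing-near-Θ ab xy ex ey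
  ... | inj₂ ex | inj₁ ey = crossing-near-Θ ab (~-sym xy) ey ex ◅◅ Θ-swap

  -- Geodesics, separation and convexity of halfspaces.

  towards⇒Sep : ∀ {x y z} → x ~ z → d x y ≡ suc (d z y) → Sep (x , z) x y
  towards⇒Sep {x} {y} {z} r eq same =
    case trans (sym (side-near (trans (~⇒d≡1 r) (cong suc (sym (d-refl x))))))
         (trans same (side-far (trans (d-sym y x) (trans eq (cong suc (d-sym z y)))))) of λ ()

  Sep⇒towards : ∀ {x y z} → x ~ z → Sep (x , z) x y → d x y ≡ suc (d z y)
  Sep⇒towards {x} {y} {z} r sep with edge-cases r y
  ... | inj₁ e = contradiction
        (trans (side-near (trans (~⇒d≡1 r) (cong suc (sym (d-refl x))))) (sym (side-near e))) sep
  ... | inj₂ e = trans (d-sym x y) (trans e (cong suc (d-sym y z)))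

  Sep-own : ∀ {x y} → x ~ y → Sep (x , y) x y
  Sep-own {x} {y} r = towards⇒Sep r (trans (~⇒d≡1 r) (cong suc (sym (d-refl y))))

  -- If xp separated x from q, then p would lie on a geodesic from x to q, which has length 1, so p
  -- = q.
  Same-neighbour : ∀ {x p q} → x ~ p → x ~ q → p ≢ q → Same (x , p) x q
  Same-neighbour {x} {p} {q} xp xq p≢q with same? (x , p) x q
  ... | yes same = same
  ... | no sep = contradiction (d≡0⇒≡ (suc-injective (trans (sym (Sep⇒towards xp sep)) (~⇒d≡1 xq)))) p≢q

  -- A geodesic crosses a class at most once. If its first edge xz crosses e, then xz is in the
  -- class of e and, leading towards y, separates x from y; otherwise the induction passes to z.
  Sep-along : ∀ {e} n x {y m} → d x m ≡ n → IsEdge e → I x y m → Sep e x m → Sep e x y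
  Sep-along zero x eq ed i sep = contradiction (cong (side _) (d≡0⇒≡ eq)) sep
  Sep-along {e} (suc n) x {y} {m} eq ed i sep
    with z , xz , ez ← step-towards {x} {m} (λ { refl → sep refl })
    with zym , xy ← I-step xz ez i
    with same? e x z
  ... | no xz-sep = let s = crossing⇒Θ ed xz xz-sep in
        Sep-Θ (Θ-sym s) xz (towards⇒Sep xz xy)
  ... | yes same = λ same′ → Sep-along n z (suc-injective (trans (sym ez) eq)) ed zym
        (λ q → sep (trans same q)) (trans (sym same) same′)

  halfspace-convex : ∀ {e x y m} → IsEdge e → I x y m → Same e x y → Same e x m
  halfspace-convex {e} {x} {y} {m} ed i same with same? e x m
  ... | yes s = s
  ... | no sep = contradiction same (Sep-along (d x m) x refl ed i sep)

  Sep-extend : ∀ {e x y m} → IsEdge e → I x y m → Sep e x m → Sep e x y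
  Sep-extend ed i sep same = sep (halfspace-convex ed i same)

  ≢⇒Sep : ∀ {x y} → x ≢ y → Σ Pair λ e → IsEdge e × Sep e x y
  ≢⇒Sep {x} {y} x≢y with z , xz , eq ← step-towards x≢y = (x , z) , xz , towards⇒Sep xz eq

  Same⇒≡ : ∀ {x y} → (∀ e → IsEdge e → Same e x y) → x ≡ y
  Same⇒≡ {x} {y} same with x ≟ y
  ... | yes eq = eq
  ... | no x≢y with e , ed , sep ← ≢⇒Sep x≢y = contradiction (same e ed) sep

  -- An edge from m towards the median of m, x and y would separate m from both x and y.
  between : ∀ {x y m} → (∀ e → IsEdge e → Sep e m x → Same e m y) → I x y m
  between {x} {y} {m} h with median m x y
  ... | m′ , (mxm′ , xym′ , ymm′) , _ with m ≟ m′
  ... | yes refl = xym′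
  ... | no m≢m′ with e , ed , sep ← ≢⇒Sep m≢m′ =
    contradiction (h e ed (Sep-extend ed mxm′ sep)) (Sep-extend ed (I-sym ymm′) sep)

  -- If the first edge xz of a geodesic to y stopped short of y, an edge separating z from y would
  -- be in the class of xz, and the geodesic would cross that class twice.
  single-class⇒~ : ∀ {e x y} → IsEdge e → Sep e x y → (∀ f → IsEdge f → Sep f x y → Θ e f) → x ~ y
  single-class⇒~ {e} {x} {y} ed sep only with z , xz , eq ← step-towards {x} {y} (λ { refl → sep refl })
    with z ≟ y
  ... | yes refl = xz
  ... | no z≢y with f , fd , sepf ← ≢⇒Sep z≢y =
    contradiction (≢∧≢⇒≡ (Sep-own xz ∘ sym) (towards⇒Sep xz eq)) (Sep-Θ (Θ-sym xz~f) fd sepf)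
    where
    xz~f : Θ (x , z) f
    xz~f with same? f x z
    ... | yes same = Θ-sym (only (x , z) xz (towards⇒Sep xz eq))
                     ◅◅ only f fd (λ q → sepf (trans (sym same) q))
    ... | no sep′ = Θ-sym (crossing⇒Θ fd xz sep′)

  -- A walk that changes sides does so on an edge, which `crossing⇒Θ` places in the forbidden class.
  Sep⇒Separates : ∀ {e x y} → IsEdge e → Sep e x y → Separates e x y
  Sep⇒Separates ed sep _ [] = sep refl
  Sep⇒Separates {e} {x} ed sep _ (_∷_ {y = z} (r , ¬Θ) w) with same? e x z
  ... | yes same = Sep⇒Separates ed (sep ∘ trans same) _ w
  ... | no sep′ = ¬Θ (Θ-sym (crossing⇒Θ ed r sep′))

  -- If x and y were on one side, a geodesic between them would be a walk avoiding the class: an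
  -- edge of the class on it would separate its ends.
  Separates⇒Sep : ∀ {e x y} → IsEdge e → Separates e x y → Sep e x y
  Separates⇒Sep {e} {x} {y} ed separates same = separates _ (geodesic (d x y) x refl same)
    where
    geodesic : ∀ n x → d x y ≡ n → Same e x y → Walk (λ a b → a ~ b × ¬ Θ (a , b) e) x y n
    geodesic zero x eq _ rewrite d≡0⇒≡ eq = []
    geodesic (suc n) x eq same
      with z , xz , ez ← step-towards {x} {y} (λ { refl → 0≢1+n (trans (sym (d-refl x)) eq) }) =
      (xz , avoid) ∷ geodesic n z (suc-injective (trans (sym ez) eq)) (trans (sym same-xz) same)
      where
      avoid : ¬ Θ (x , z) e
      avoid s = Sep-Θ s xz (towards⇒Sep xz ez) same
      same-xz : Same e x z
      same-xz with same? e x z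
      ... | yes s = s
      ... | no sep = contradiction (Θ-sym (crossing⇒Θ ed xz sep)) avoid

  -- Edges of a class at a vertex, and orthogonality.

  Incident : Pair → V → Set
  Incident e x = Σ V λ z → x ~ z × Θ (x , z) e

  Incident-Θ : ∀ {e f x} → Θ e f → Incident e x → Incident f x
  Incident-Θ s (z , xz , s′) = z , xz , s′ ◅◅ s

  -- Both edges at x start geodesics to t, so the quadrangle condition closes them into a square.
  square-at : ∀ {e f x p q t} → x ~ p → Θ (x , p) e → x ~ q → Θ (x , q) f →
              ¬ Θ e f → Sep e x t → Sep f x t → Σ V λ m → Square x p m q
  square-at xp pe xq qf ¬Θ sepe sepf
    with m , sq , _ ← quadrangle xp xq (λ { refl → ¬Θ (Θ-sym pe ◅◅ qf) })
                       (Sep⇒towards xp (Sep-Θ (Θ-sym pe) (Θ-edge pe xp) sepe))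
                       (Sep⇒towards xq (Sep-Θ (Θ-sym qf) (Θ-edge qf xq) sepf)) = m , sq

  incident⇒Orth : ∀ {e f x t} → Incident e x → Incident f x → ¬ Θ e f → Sep e x t → Sep f x t → Orth e f
  incident⇒Orth {x = x} (p , xp , pe) (q , xq , qf) ¬Θ sepe sepf
    with m , sq@(_ , pm , mq , qx , x≢m , p≢q) ← square-at xp pe xq qf ¬Θ sepe sepf =
    x , p , m , q , sq , pe , (inj₁ (inj₂ (mq , qx , xp , pm , x≢m ∘ sym , p≢q ∘ sym)) ◅ pe)
    , (inj₁ (inj₂ (pm , mq , qx , xp , p≢q , x≢m ∘ sym)) ◅ (Θ-swap ◅◅ qf)) , (Θ-swap ◅◅ qf)

  -- The corners of a square of the two classes meet all four intersections of their halfspaces.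
  Orth⇒opposite : ∀ {e f} → Orth e f → ∀ x → Σ V λ t → Sep e x t × Sep f x t
  Orth⇒opposite {e} {f} (a , b , c , c′ , (ab , bc , cd , da , a≢c , b≢d) , abe , cde , bcf , daf) x
    with same? e x a | same? f x b
  ... | no ea  | no fb  = a , ea , λ fa → fb (trans fa (sym fba))
    where
    fba : Same f b a
    fba = Same-Θ bcf bc (Same-neighbour bc (~-sym ab) (a≢c ∘ sym))
  ... | no ea  | yes fb = c′ , (λ q → ea (trans q (sym ead))) , λ q → fbd (trans (sym fb) q)
    where
    ead : Same e a c′
    ead = Same-Θ abe ab (Same-neighbour ab (~-sym da) b≢d)
    fbd : Sep f b c′
    fbd q = Sep-Θ bcf bc (Sep-own bc) (trans q (sym (Same-Θ (Θ-swap ◅◅ bcf) (~-sym bc)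
              (Same-neighbour (~-sym bc) cd b≢d))))
  ... | yes ea | no fb  = b , (λ q → Sep-Θ abe ab (Sep-own ab) (trans (sym ea) q)) , fb
  ... | yes ea | yes fb = c , (λ q → Sep-Θ abe ab (Sep-own ab) (trans (sym ea) (trans q (sym ebc))))
                            , (λ q → Sep-Θ bcf bc (Sep-own bc) (trans (sym fb) q))
    where
    ebc : Same e b c
    ebc = Same-Θ (Θ-swap ◅◅ abe) (~-sym ab) (Same-neighbour (~-sym ab) bc a≢c)

  -- The median of p and the e-neighbours of x and y differs from p in the class e only.
  boundary-convex : ∀ {e x y p} → IsEdge e → Incident e x → Incident e y → Same e x y → I x y p → Incident e p
  boundary-convex {e} {x} {y} {p} ed (z , xz , ze) (z′ , yz , ze′) same i
    with m , (pzm , zzm , zpm) , _ ← median p z z′ =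
    m , p~m , Θ-sym (crossing⇒Θ ed p~m sep-pm)
    where
    sep-xz : Sep e x z
    sep-xz = Sep-Θ ze xz (Sep-own xz)
    sep-yz : Sep e y z′
    sep-yz = Sep-Θ ze′ yz (Sep-own yz)
    same-zz : Same e z z′
    same-zz = ≢∧≢⇒≡ (sep-xz ∘ sym) (λ q → sep-yz (trans (sym same) q))
    sep-pm : Sep e p m
    sep-pm q = sep-xz (trans (halfspace-convex ed i same) (trans q (sym (halfspace-convex ed zzm same-zz))))
    only : ∀ f → IsEdge f → Sep f p m → Θ e f
    only f fd sep with same? f x z | same? f y z′
    ... | no s | _ = Θ-sym ze ◅◅ Θ-sym (crossing⇒Θ fd xz s)
    ... | yes _ | no s = Θ-sym ze′ ◅◅ Θ-sym (crossing⇒Θ fd yz s)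
    -- Here f splits neither xz nor yz′, so p shares its side with z or with z′, and m, lying in
    -- both I(p,z) and I(p,z′), stays on that side.
    ... | yes sx | yes sy with same? f x p
    ... | yes s = contradiction (halfspace-convex fd pzm (trans (sym s) sx)) sep
    ... | no s = contradiction
          (halfspace-convex fd (I-sym zpm) (trans (≢∧≢⇒≡ (s ∘ sym) (Sep-extend fd i s)) sy)) sep
    p~m : p ~ m
    p~m = single-class⇒~ ed sep-pm only

  -- Hypercubes and their classes.

  flip : ∀ {n} → Fin n → Subset n → Subset n
  flip i A = updateAt A i not

  flip-involutive : ∀ {n} (i : Fin n) (A : Subset n) → flip i (flip i A) ≡ A
  flip-involutive i A = trans (updateAt-updateAt i A) (updateAt-id-local i A (Bool.not-involutive _))

  QAdj-flip : ∀ {n} (i : Fin n) (A : Subset n) → QAdj A (flip i A)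
  QAdj-flip i A = i , (λ eq → Bool.not-¬ refl (trans eq (lookup∘updateAt i A)))
                    , λ j j≢i → sym (lookup∘updateAt′ j i j≢i A)

  lookup-ext : ∀ {n} {A B : Subset n} → (∀ i → lookup A i ≡ lookup B i) → A ≡ B
  lookup-ext {A = A} {B} h = trans (sym (tabulate∘lookup A)) (trans (tabulate-cong h) (tabulate∘lookup B))

  QAdj⇒flip : ∀ {n} (A B : Subset n) ((i , _) : QAdj A B) → B ≡ flip i A
  QAdj⇒flip A B (i , differ , agree) = lookup-ext same
    where
    same : ∀ j → lookup B j ≡ lookup (flip i A) j
    same j with j Fin.≟ i
    ... | yes refl = trans (Bool.¬-not (differ ∘ sym)) (sym (lookup∘updateAt i A))
    ... | no j≢i = trans (sym (agree j j≢i)) (sym (lookup∘updateAt′ j i j≢i A))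

  -- Connectivity of the Boolean cube, used as an induction principle.
  flip-induction : ∀ {n} (P : Subset n → Set) → (∀ A i → P A → P (flip i A)) → ∀ {A B} → P A → P B
  flip-induction P flipped {[]} {[]} p = p
  flip-induction P flipped {a ∷ A} {b ∷ B} p with a Bool.≟ b
  ... | yes refl = flip-induction (P ∘ (a ∷_)) (λ A i → flipped (a ∷ A) (suc i)) {A} {B} p
  ... | no a≢b = subst (λ c → P (c ∷ B)) (sym (Bool.¬-not (a≢b ∘ sym))) (flipped (a ∷ B) zero
                   (flip-induction (P ∘ (a ∷_)) (λ A i → flipped (a ∷ A) (suc i)) {A} {B} p))

  module _ (c : HCube) where

    cube-edge : ∀ A i → f c A ~ f c (flip i A)
    cube-edge A i = proj₂ (f-adj c A (flip i A)) (QAdj-flip i A)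

    cube-square : ∀ A {i j} → i ≢ j →
                  Square (f c A) (f c (flip i A)) (f c (flip i (flip j A))) (f c (flip j A))
    cube-square A {i} {j} i≢j =
        cube-edge A i
      , subst (λ B → f c (flip i A) ~ f c B) (updateAt-commutes j i (i≢j ∘ sym) A) (cube-edge (flip i A) j)
      , ~-sym (cube-edge (flip j A) i)
      , ~-sym (cube-edge A j)
      , (λ eq → Bool.not-¬ refl (trans (cong (λ B → lookup B i) (f-inj c _ _ eq))
                  (trans (lookup∘updateAt i (flip j A)) (cong not (lookup∘updateAt′ i j i≢j A)))))
      , (λ eq → Bool.not-¬ refl (trans (sym (lookup∘updateAt′ i j i≢j A))
                  (trans (cong (λ B → lookup B i) (sym (f-inj c _ _ eq))) (lookup∘updateAt i A))))

    -- Flipping a coordinate other than i moves the edge across a square; flipping i itself only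
    -- reverses it.
    cube-parallel : ∀ i {A B} → Θ (f c A , f c (flip i A)) (f c B , f c (flip i B))
    cube-parallel i {A} {B} = flip-induction (λ B → Θ (f c A , f c (flip i A)) (f c B , f c (flip i B)))
      move {A} {B} ε
      where
      move : ∀ B j → Θ (f c A , f c (flip i A)) (f c B , f c (flip i B)) →
             Θ (f c A , f c (flip i A)) (f c (flip j B) , f c (flip i (flip j B)))
      move B j s with i Fin.≟ j
      ... | yes refl = s ◅◅ subst (λ C → Θ (f c B , f c (flip i B)) (f c (flip i B) , f c C))
                                  (sym (flip-involutive i B)) Θ-swap
      ... | no i≢j = s ◅◅ (inj₁ (inj₁ (cube-square B i≢j)) ◅ ε)

    -- Parallel edges share a class, so a class of the hypercube is a coordinate and has an edge at
    -- every vertex of the hypercube.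
    class-direction : ∀ {e} → ClassesOf c e → Σ (Fin (k c)) λ i → ∀ A → Θ (f c A , f c (flip i A)) e
    class-direction (A , B , adj@(i , _) , s) with refl ← QAdj⇒flip A B adj =
      i , λ A′ → cube-parallel i {A′} {A} ◅◅ s

    ClassesOf-edge : ∀ {e} → ClassesOf c e → IsEdge e
    ClassesOf-edge (A , B , adj , s) = Θ-edge s (proj₂ (f-adj c A B) adj)

    -- On the way from A to B by single flips, some flip changes the side of e, and its edge lies in
    -- the class of e.
    Sep⇒ClassesOf : ∀ {e A B} → IsEdge e → Sep e (f c A) (f c B) → ClassesOf c e
    Sep⇒ClassesOf {e} {A} {B} ed = flip-induction (λ B → Sep e (f c A) (f c B) → ClassesOf c e) move {A} {B}
                                     (λ sep → contradiction refl sep)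
      where
      move : ∀ B i → (Sep e (f c A) (f c B) → ClassesOf c e) →
             Sep e (f c A) (f c (flip i B)) → ClassesOf c e
      move B i h sep with same? e (f c B) (f c (flip i B))
      ... | yes same = h (λ q → sep (trans q same))
      ... | no sep′ = B , flip i B , QAdj-flip i B , Θ-sym (crossing⇒Θ ed (cube-edge B i) sep′)

    -- Otherwise the flip in the direction of the class would lead from the basis to a vertex nearer
    -- to `v0`.
    basis-side : ∀ {e x} → HasBasis c x → ClassesOf c e → Same e x v0
    basis-side ((A , refl) , below) cl with i , dir ← class-direction cl =
      Same-Θ (dir A) (cube-edge A i) same
      where
      same : Same (f c A , f c (flip i A)) (f c A) v0
      same with same? (f c A , f c (flip i A)) (f c A) v0
      ... | yes s = s
      ... | no sep = contradiction (subst₂ _≤_ (d-sym v0 _) (d-sym v0 _) (below (flip i A)))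
                       (<⇒≱ (≤-reflexive (sym (Sep⇒towards (cube-edge A i) sep))))

    antibasis-side : ∀ {e w} → HasAntiBasis c w → ClassesOf c e → Sep e w v0
    antibasis-side {e} ((A , refl) , above) cl with i , dir ← class-direction cl =
      Sep-Θ (dir A) (cube-edge A i) sep
      where
      sep : Sep (f c A , f c (flip i A)) (f c A) v0
      sep same = <⇒≱ (≤-reflexive (sym (Sep⇒towards (~-sym (cube-edge A i))
          (Sep-Θ Θ-swap (cube-edge A i) λ q → Sep-own (cube-edge A i) (trans same (sym q))))))
        (subst₂ _≤_ (d-sym v0 _) (d-sym v0 _) (above (flip i A)))

    cube-class⇔Sep : ∀ {e x w} → HasBasis c x → HasAntiBasis c w → IsEdge e → ClassesOf c e ⇔ Sep e x w
    cube-class⇔Sep {e} b@((A , refl) , _) a@((B , refl) , _) ed = mk⇔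
      (λ cl q → antibasis-side a cl (trans (sym q) (basis-side b cl)))
      (Sep⇒ClassesOf ed)

  -- Anti-bases and ladder sets.

  anti⇔Sep : ∀ {x S w e} → IsClassSet S → AntiBasisOf x S w → IsEdge e → S e ⇔ Sep e x w
  anti⇔Sep cs (c , b , (sub , sup) , a) ed = mk⇔
    (λ s → to (cube-class⇔Sep c b a ed) (sup _ s))
    (λ sep → let A , B , adj , θ = from (cube-class⇔Sep c b a ed) sep in proj₂ cs _ _ θ (sub A B adj))

  -- An edge separating x from w lies in a class of the hypercube, and then `basis-side` puts x on
  -- the side of `v0`; so no edge separates x from both.
  anti-I : ∀ {x S w} → AntiBasisOf x S w → I v0 w x
  anti-I {x} {S} {w} (c , b , _ , a) = between λ e ed sep →
    case same? e x w of λ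
      { (yes same) → same
      ; (no sep′) → contradiction (basis-side c b (from (cube-class⇔Sep c b a ed) sep′)) sep }

  anti-resp : ∀ {x S S′ w} → (∀ e → S e → S′ e) → (∀ e → S′ e → S e) → AntiBasisOf x S w → AntiBasisOf x S′ w
  anti-resp h h′ (c , b , (sub , sup) , a) = c , b , ((λ A B q → h _ (sub A B q)) , λ e s → sup e (h′ e s)) , a

  -- The basis and the signature fix the side of every edge on which the anti-basis lies.
  anti-unique : ∀ {x S w w′} → IsClassSet S → AntiBasisOf x S w → AntiBasisOf x S w′ → w ≡ w′
  anti-unique {x} {w = w} {w′} cs a a′ = Same⇒≡ λ e ed → case (same? e x w , same? e x w′) of λ
    { (yes p , yes q) → trans (sym p) q
    ; (yes p , no q) → contradiction p (to (anti⇔Sep cs a ed) (from (anti⇔Sep cs a′ ed) q))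
    ; (no p , yes q) → contradiction q (to (anti⇔Sep cs a′ ed) (from (anti⇔Sep cs a ed) p))
    ; (no p , no q) → ≢∧≢⇒≡ (p ∘ sym) q }

  Ladder-IsClassSet : ∀ x y → IsClassSet (Ladder x y)
  Ladder-IsClassSet x y = (λ _ → proj₁) , λ e f s (ed , sep , inc) →
    Θ-edge s ed , Sep⇒Separates (Θ-edge s ed) (Sep-Θ s ed (Separates⇒Sep ed sep)) , Incident-Θ s inc

  ladder : ∀ {e x y} → IsEdge e → Sep e x y → Incident e x → Ladder x y e
  ladder ed sep inc = ed , Sep⇒Separates ed sep , inc

  Ladder-Sep : ∀ {e x y} → Ladder x y e → Sep e x y
  Ladder-Sep (ed , sep , _) = Separates⇒Sep ed sep

  -- Construction of the hypercube of a ladder set.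

  med : V → V → V → V
  med x y z = proj₁ (median x y z)

  -- The interval I(x,y) is a lattice in which the median of a, b and y is the join of a and b;
  -- the joins of the neighbours zs of x in it are the vertices of the ladder cube.
  module LadderCube (x y : V) where

    join : (zs : List V) → Subset (length zs) → V
    join []       []          = x
    join (z ∷ zs) (true  ∷ A) = med z (join zs A) y
    join (z ∷ zs) (false ∷ A) = join zs A

    -- By convexity a join crosses only classes that the new neighbour or the previous join has
    -- already crossed.
    Sep-join⇒∈ : ∀ {e} zs A → IsEdge e → (∀ i → x ~ List.lookup zs i) → Sep e x (join zs A) →
                 Σ (Fin (length zs)) λ i → lookup A i ≡ true × Θ (x , List.lookup zs i) e
    Sep-join⇒∈ [] [] ed adj sep = contradiction refl sep
    Sep-join⇒∈ (z ∷ zs) (false ∷ A) ed adj sep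
      with i , eq , s ← Sep-join⇒∈ zs A ed (adj ∘ suc) sep = suc i , eq , s
    Sep-join⇒∈ {e} (z ∷ zs) (true ∷ A) ed adj sep with same? e x z | same? e x (join zs A)
    ... | no s | _ = zero , refl , Θ-sym (crossing⇒Θ ed (adj zero) s)
    ... | yes _ | no s with i , eq , s ← Sep-join⇒∈ zs A ed (adj ∘ suc) s = suc i , eq , s
    ... | yes p | yes q with m , (zjm , _) , _ ← median z (join zs A) y =
      contradiction (trans p (halfspace-convex ed zjm (trans (sym p) q))) sep

    -- Once a chosen class is crossed, the vertex is on the side of y, and medians taken with y
    -- remain there.
    ∈⇒Sep-join : ∀ zs A → (∀ i → x ~ List.lookup zs i) → (∀ i → Sep (x , List.lookup zs i) x y) →
                 ∀ i → lookup A i ≡ true → Sep (x , List.lookup zs i) x (join zs A)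
    ∈⇒Sep-join (z ∷ zs) (true ∷ A) adj sep zero _ q with m , (_ , _ , yzm) , _ ← median z (join zs A) y =
      sep zero (trans q (sym (halfspace-convex (adj zero) yzm (≢∧≢⇒≡ (sep zero ∘ sym) (Sep-own (adj zero))))))
    ∈⇒Sep-join (z ∷ zs) (true ∷ A) adj sep (suc i) eq q with m , (_ , jym , _) , _ ← median z (join zs A) y =
      sep (suc i) (trans q (trans (sym (halfspace-convex (adj (suc i)) jym j~y)) j~y))
      where
      j~y = ≢∧≢⇒≡ (∈⇒Sep-join zs A (adj ∘ suc) (sep ∘ suc) i eq ∘ sym) (sep (suc i))
    ∈⇒Sep-join (z ∷ zs) (false ∷ A) adj sep (suc i) eq = ∈⇒Sep-join zs A (adj ∘ suc) (sep ∘ suc) i eq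

    -- Adjacency is tested as distance 1, which is decidable.
    upward? : ∀ z → Dec (d x z ≡ 1 × d x y ≡ suc (d z y))
    upward? z = (d x z ≟ℕ 1) ×-dec (d x y ≟ℕ suc (d z y))

    -- With repetitions removed, positions in the list correspond to classes; injectivity of
    -- `vertex` rests on this.
    zs : List V
    zs = deduplicate _≟_ (filter upward? (proj₁ finite))

    z[_] : Fin (length zs) → V
    z[ i ] = List.lookup zs i

    z-upward : ∀ i → d x z[ i ] ≡ 1 × d x y ≡ suc (d z[ i ] y)
    z-upward i = proj₂ (∈-filter⁻ upward? {xs = proj₁ finite} (∈-deduplicate⁻ _≟_ _ (∈-lookup {xs = zs} i)))

    z-adj : ∀ i → x ~ z[ i ]
    z-adj i = d≡1⇒~ (proj₁ (z-upward i))

    z-sep : ∀ i → Sep (x , z[ i ]) x y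
    z-sep i = towards⇒Sep (z-adj i) (proj₂ (z-upward i))

    z-complete : ∀ {z} → x ~ z → Sep (x , z) x y → Σ (Fin (length zs)) λ i → z ≡ z[ i ]
    z-complete {z} r sep = index z∈ , lookup-index z∈
      where
      z∈ : z ∈ zs
      z∈ = ∈-deduplicate⁺ _≟_ (∈-filter⁺ upward? (proj₂ finite z) (~⇒d≡1 r , Sep⇒towards r sep))

    zs-unique : Unique zs
    zs-unique = deduplicate-! _≟_ (filter upward? (proj₁ finite))

    z-Θ⇒≡ : ∀ {i j} → Θ (x , z[ i ]) (x , z[ j ]) → i ≡ j
    z-Θ⇒≡ {i} {j} s with z[ i ] ≟ z[ j ]
    ... | yes eq = lookup-injective zs-unique eq
    ... | no z≢ = contradiction (Same-neighbour (z-adj i) (z-adj j) z≢)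
                    (Sep-Θ (Θ-sym s) (z-adj j) (Sep-own (z-adj j)))

    vertex : Subset (length zs) → V
    vertex = join zs

    vertex-sep : ∀ {A e} → IsEdge e → Sep e x (vertex A) →
                 Σ (Fin (length zs)) λ i → lookup A i ≡ true × Θ (x , z[ i ]) e
    vertex-sep {A} ed = Sep-join⇒∈ zs A ed z-adj

    sep-vertex : ∀ A i → lookup A i ≡ true → Sep (x , z[ i ]) x (vertex A)
    sep-vertex A = ∈⇒Sep-join zs A z-adj z-sep

    same-vertex : ∀ A i → lookup A i ≡ false → Same (x , z[ i ]) x (vertex A)
    same-vertex A i eq with same? (x , z[ i ]) x (vertex A)
    ... | yes s = s
    ... | no s with j , eq′ , θ ← vertex-sep {A} (z-adj i) s =
      case trans (sym eq) (trans (cong (lookup A) (sym (z-Θ⇒≡ θ))) eq′) of λ ()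

    ≡⇒Same : ∀ A B i → lookup A i ≡ lookup B i → Same (x , z[ i ]) (vertex A) (vertex B)
    ≡⇒Same A B i eq with lookup A i in eqA
    ... | true  = ≢∧≢⇒≡ (sep-vertex A i eqA ∘ sym) (sep-vertex B i (sym eq))
    ... | false = trans (sym (same-vertex A i eqA)) (same-vertex B i (sym eq))

    ≢⇒Sep-vertices : ∀ A B i → lookup A i ≢ lookup B i → Sep (x , z[ i ]) (vertex A) (vertex B)
    ≢⇒Sep-vertices A B i ne q with lookup A i in eqA | lookup B i in eqB
    ... | true  | true  = ne refl
    ... | false | false = ne refl
    ... | true  | false = sep-vertex A i eqA (trans (same-vertex B i eqB) (sym q))
    ... | false | true  = sep-vertex B i eqB (trans (same-vertex A i eqA) q)

    Sep-vertices : ∀ {e} A B → IsEdge e → Sep e (vertex A) (vertex B) →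
                   Σ (Fin (length zs)) λ i → lookup A i ≢ lookup B i × Θ (x , z[ i ]) e
    Sep-vertices {e} A B ed sep = let i , θ = found in
      i , (λ eq → sep (Same-Θ θ (z-adj i) (≡⇒Same A B i eq))) , θ
      where
      found : Σ (Fin (length zs)) λ i → Θ (x , z[ i ]) e
      found with same? e x (vertex A)
      ... | no s with i , _ , θ ← vertex-sep {A} ed s = i , θ
      ... | yes s with i , _ , θ ← vertex-sep {B} ed (λ q → sep (trans (sym s) q)) = i , θ

    cube : HCube
    cube .k = length zs
    cube .f = vertex
    cube .f-inj A B eq = lookup-ext λ i → case lookup A i Bool.≟ lookup B i of λ
      { (yes p) → p ; (no ne) → contradiction (cong (side (x , z[ i ])) eq) (≢⇒Sep-vertices A B i ne) }
    cube .f-adj A B = adjacent⇒QAdj , QAdj⇒adjacent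
      where
      adjacent⇒QAdj : vertex A ~ vertex B → QAdj A B
      adjacent⇒QAdj r with i , ne , θ ← Sep-vertices A B r (Sep-own r) =
        i , ne , λ j j≢i → case lookup A j Bool.≟ lookup B j of λ
          { (yes p) → p
          ; (no ne′) → contradiction (z-Θ⇒≡ (crossing⇒Θ (z-adj j) r (≢⇒Sep-vertices A B j ne′) ◅◅ Θ-sym θ)) j≢i }
      QAdj⇒adjacent : QAdj A B → vertex A ~ vertex B
      QAdj⇒adjacent (i , ne , agree) = single-class⇒~ (z-adj i) (≢⇒Sep-vertices A B i ne) only
        where
        only : ∀ e → IsEdge e → Sep e (vertex A) (vertex B) → Θ (x , z[ i ]) e
        only e ed sep with j , ne′ , θ ← Sep-vertices A B ed sep with j Fin.≟ i
        ... | yes refl = θ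
        ... | no j≢i = contradiction (agree j j≢i) ne′

    vertex-Sep-y : ∀ A {e} → IsEdge e → Sep e x (vertex A) → Sep e x y
    vertex-Sep-y A ed sep with i , _ , θ ← vertex-sep {A} ed sep = Sep-Θ θ (z-adj i) (z-sep i)

    vertex-∅ : vertex ∅ ≡ x
    vertex-∅ = sym (Same⇒≡ λ e ed → case same? e x (vertex ∅) of λ
      { (yes s) → s
      ; (no s) → case vertex-sep {∅} ed s of λ (i , eq , _) →
          case trans (sym eq) (lookup-replicate i false) of λ () })

    ladder-antibasis : I v0 y x → AntiBasisOf x (Ladder x y) (vertex ⊤)
    ladder-antibasis i = cube , ((∅ , vertex-∅) , λ B → I⇒≤ (below B)) , (sound , complete)
                              , ((⊤ , refl) , λ B → I⇒≤ (above B))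
      where
      -- A class crossed inside the cube separates x from y; as x lies in I(`v0`,y), it cannot
      -- separate x from `v0` as well.
      v0-side : ∀ A {e} → IsEdge e → Sep e x (vertex A) → Same e x v0
      v0-side A {e} ed sep with same? e x v0
      ... | yes s = s
      ... | no s = contradiction (sym (≢∧≢⇒≡ (s ∘ sym) (vertex-Sep-y A ed sep)))
                     (λ q → s (sym (halfspace-convex ed i (sym q))))
      below : ∀ B → I v0 (vertex B) x
      below B = between λ e ed sep → case same? e x (vertex B) of λ
        { (yes s) → s ; (no s) → contradiction (v0-side B ed s) sep }
      above : ∀ B → I v0 (vertex ⊤) (vertex B)
      above B = between λ e ed sep → case same? e x (vertex B) of λ
        { (no s) → case vertex-sep {B} ed s of λ (j , _ , θ) →
            ≢∧≢⇒≡ (s ∘ sym) (Sep-Θ θ (z-adj j) (sep-vertex ⊤ j (lookup-replicate j true)))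
        ; (yes s) → case same? e x (vertex ⊤) of λ
            { (yes s′) → trans (sym s) s′
            ; (no s′) → contradiction (trans (sym s) (v0-side ⊤ ed s′)) sep } }
      sound : ∀ A B → QAdj A B → Ladder x y (vertex A , vertex B)
      sound A B adj with r ← proj₂ (f-adj cube A B) adj
        with j , _ , θ ← Sep-vertices A B r (Sep-own r) =
        ladder r (Sep-Θ θ (z-adj j) (z-sep j)) (_ , z-adj j , θ)
      complete : ∀ e → Ladder x y e → ClassesOf cube e
      complete e l@(ed , _ , z , xz , θ)
        with i , refl ← z-complete xz (Sep-Θ (Θ-sym θ) ed (Ladder-Sep l)) =
        Sep⇒ClassesOf cube {A = ∅} {⊤} ed
          (subst (λ t → Sep e t (vertex ⊤)) (sym vertex-∅)
            (Sep-Θ θ xz (sep-vertex ⊤ i (lookup-replicate i true))))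

  abstract
    ladder-next-exists : ∀ {x y} → I v0 y x → Σ V (AntiBasisOf x (Ladder x y))
    ladder-next-exists {x} {y} i = _ , LadderCube.ladder-antibasis x y i

  -- Nested intervals and the existence of milestones.

  -- The converse of `between`: if x and y were both across e from m, convexity would put m with
  -- them.
  I⇒Same : ∀ {e x y m} → IsEdge e → I x y m → Sep e m x → Same e m y
  I⇒Same {e} {x} {y} {m} ed i sep with same? e m y
  ... | yes s = s
  ... | no s = contradiction (sym (halfspace-convex ed i (≢∧≢⇒≡ (sep ∘ sym) s))) sep

  I-trans : ∀ {a b c t} → I a c b → I b c t → I a c t
  I-trans {b = b} {t = t} i j = between λ e ed sep → case same? e t b of λ
    { (yes s) → trans s (I⇒Same ed i (sep ∘ trans s)) ; (no s) → I⇒Same ed j s }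

  I-inner : ∀ {a b c t} → I a c b → I b c t → I a t b
  I-inner i j = between λ e ed sep → halfspace-convex ed j (I⇒Same ed i sep)

  I-innerˡ : ∀ {a b c t} → I a c b → I a b t → I t c b
  I-innerˡ i j = I-sym (I-inner (I-sym i) (I-sym j))

  ladder-next-I : ∀ {x y x⁺} → AntiBasisOf x (Ladder x y) x⁺ → I x y x⁺
  ladder-next-I {x} {y} a = between λ e ed sep →
    ≢∧≢⇒≡ sep (Ladder-Sep (from (anti⇔Sep (Ladder-IsClassSet x y) a ed) (sep ∘ sym)))

  ladder-next-closer : ∀ {x y x⁺} → AntiBasisOf x (Ladder x y) x⁺ → x⁺ ≢ y → d x⁺ y < d x y
  ladder-next-closer {x} {y} {x⁺} a x⁺≢y = ≤∧≢⇒< (I⇒≤ʳ i) λ eq →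
    x≢x⁺ (d≡0⇒≡ (+-cancelʳ-≡ (d x⁺ y) (d x x⁺) 0 (trans i (sym eq))))
    where
    i = ladder-next-I a
    x≢y : x ≢ y
    x≢y refl = x⁺≢y (d≡0⇒≡ (n≤0⇒n≡0 (subst (d x⁺ y ≤_) (d-refl x) (I⇒≤ʳ i))))
    x≢x⁺ : x ≢ x⁺
    -- An edge from x towards y has its class in the ladder set, so this class separates x from x⁺.
    x≢x⁺ refl with z , xz , eq ← step-towards x≢y =
      to (anti⇔Sep (Ladder-IsClassSet x y) a xz) (ladder xz (towards⇒Sep xz eq) (z , xz , ε)) refl

  -- The bound n is the recursion measure: by `ladder-next-closer` every milestone short of y lowers
  -- the distance to y.
  milestones-exist : ∀ n {x y} → d x y ≤ n → I v0 y x → Σ (List V) (Milestones x y)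
  milestones-exist n {x} {y} le i = extend n le (ladder-next-exists i)
    where
    extend : ∀ n → d x y ≤ n → Σ V (AntiBasisOf x (Ladder x y)) → Σ (List V) (Milestones x y)
    extend n le (x⁺ , a) with x⁺ ≟ y
    ... | yes refl = _ , done i a
    extend zero le (x⁺ , a) | no x⁺≢y = contradiction (≤-trans (ladder-next-closer a x⁺≢y) le) λ ()
    extend (suc n) le (x⁺ , a) | no x⁺≢y
      with ms , m ← milestones-exist n (≤-pred (≤-trans (ladder-next-closer a x⁺≢y) le))
                                       (I-trans i (ladder-next-I a)) =
      _ , step i a x⁺≢y m

  -- The penultimate milestone.

  -- Pen x y p says that p is π̄(x,y), following the recursion for Π(x,y) instead of comparing distances.
  data Pen : V → V → V → Set where
    last  : ∀ {x y} → I v0 y x → AntiBasisOf x (Ladder x y) y → Pen x y x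
    later : ∀ {x x⁺ y p} → AntiBasisOf x (Ladder x y) x⁺ → x⁺ ≢ y → Pen x⁺ y p → Pen x y p

  ladder-next-unique : ∀ {x y z z′} → AntiBasisOf x (Ladder x y) z → AntiBasisOf x (Ladder x y) z′ → z ≡ z′
  ladder-next-unique {x} {y} = anti-unique (Ladder-IsClassSet x y)

  Pen-unique : ∀ {x y p q} → Pen x y p → Pen x y q → p ≡ q
  Pen-unique (last _ _) (last _ _) = refl
  Pen-unique (last _ a) (later a′ ne _) = contradiction (ladder-next-unique a′ a) ne
  Pen-unique (later a ne _) (last _ a′) = contradiction (ladder-next-unique a a′) ne
  Pen-unique (later a _ pen) (later a′ _ pen′) with refl ← ladder-next-unique a a′ = Pen-unique pen pen′

  Pen-I : ∀ {x y p} → Pen x y p → I x y p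
  Pen-I (last _ _) = I-left
  Pen-I (later a _ pen) = I-trans (ladder-next-I a) (Pen-I pen)

  Pen-anti : ∀ {x y p} → Pen x y p → AntiBasisOf p (Ladder p y) y
  Pen-anti (last _ a) = a
  Pen-anti (later _ _ pen) = Pen-anti pen

  Milestones⇒Pen : ∀ {x y ms} → Milestones x y ms → Σ V (Pen x y)
  Milestones⇒Pen (done i a) = _ , last i a
  Milestones⇒Pen (step i a ne m) with p , pen ← Milestones⇒Pen m = p , later a ne pen

  first-milestone : ∀ {x y ms} → Milestones x y ms → x ∈ ms
  first-milestone (done _ _) = here refl
  first-milestone (step _ _ _ _) = here refl

  last-milestone : ∀ {x y ms} → Milestones x y ms → y ∈ ms
  last-milestone (done _ _) = there (here refl)
  last-milestone (step _ _ _ m) = there (last-milestone m)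

  Milestones-I : ∀ {x y z ms} → Milestones x y ms → z ∈ ms → I x y z
  Milestones-I (done _ _) (here refl) = I-left
  Milestones-I (done _ _) (there (here refl)) = I-right
  Milestones-I (step _ _ _ _) (here refl) = I-left
  Milestones-I (step _ a _ m) (there z∈) = I-trans (ladder-next-I a) (Milestones-I m z∈)

  -- The distance to y drops strictly from each milestone to the next, so all milestones before the
  -- penultimate one are farther away.
  Pen-closest : ∀ {x y p q ms} → Milestones x y ms → Pen x y p → q ∈ ms → q ≢ y → q ≡ p ⊎ d p y < d q y
  Pen-closest (done _ _) (last _ _) (here refl) _ = inj₁ refl
  Pen-closest (done _ _) _ (there (here refl)) q≢y = contradiction refl q≢y
  Pen-closest (done _ a) (later a′ ne _) (here _) _ = contradiction (ladder-next-unique a′ a) ne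
  Pen-closest (step _ a ne _) (last _ a′) _ _ = contradiction (ladder-next-unique a a′) ne
  Pen-closest (step _ a ne m) (later a′ _ pen) q∈ q≢y with refl ← ladder-next-unique a a′ with q∈
  ... | there q∈ = Pen-closest m pen q∈ q≢y
  ... | here refl = inj₂ (≤-<-trans le (ladder-next-closer a ne))
    where
    le = [ (λ eq → ≤-reflexive (cong (λ t → d t _) (sym eq))) , <⇒≤ ]′
           (Pen-closest m pen (first-milestone m) ne)

  Pen∈ : ∀ {x y p ms} → Milestones x y ms → Pen x y p → p ∈ ms
  Pen∈ m (last _ _) = first-milestone m
  Pen∈ (done _ a) (later a′ ne _) = contradiction (ladder-next-unique a′ a) ne
  Pen∈ (step _ a _ m) (later a′ _ pen) with refl ← ladder-next-unique a a′ = there (Pen∈ m pen)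

  Pen≢ : ∀ {x y p} → x ≢ y → Pen x y p → p ≢ y
  Pen≢ x≢y (last _ _) = x≢y
  Pen≢ _ (later _ ne pen) = Pen≢ ne pen

  Pen⇒Penultimate : ∀ {x y p ms} → x ≢ y → Milestones x y ms → Pen x y p → Penultimate x y p
  Pen⇒Penultimate x≢y m pen = _ , m , Pen∈ m pen , Pen≢ x≢y pen , λ q q∈ q≢y →
    [ (λ eq → ≤-reflexive (cong (λ t → d t _) (sym eq))) , <⇒≤ ]′ (Pen-closest m pen q∈ q≢y)

  Penultimate⇒Pen : ∀ {x y p} → x ≢ y → Penultimate x y p → Pen x y p
  Penultimate⇒Pen x≢y (ms , m , p∈ , p≢y , closest) with q , pen ← Milestones⇒Pen m
    with Pen-closest m pen p∈ p≢y
  ... | inj₁ refl = pen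
  ... | inj₂ lt = contradiction (closest q (Pen∈ m pen) (Pen≢ x≢y pen)) (<⇒≱ lt)

  -- `LBar` admits any hypercube between the two vertices; by `cube-class⇔Sep` its classes depend on
  -- these vertices alone.
  LBar⇒Sep : ∀ {x y p e} → x ≢ y → Pen x y p → LBar x y e → IsEdge e × Sep e p y
  LBar⇒Sep x≢y pen (p′ , pu , c , b , a , cl) with refl ← Pen-unique pen (Penultimate⇒Pen x≢y pu) =
    ed , to (cube-class⇔Sep c b a ed) cl
    where ed = ClassesOf-edge c cl

  Sep⇒LBar : ∀ {x y p e ms} → x ≢ y → Milestones x y ms → Pen x y p → IsEdge e → Sep e p y → LBar x y e
  Sep⇒LBar x≢y m pen ed sep with c , b , _ , a ← Pen-anti pen =
    _ , Pen⇒Penultimate x≢y m pen , c , b , a , from (cube-class⇔Sep c b a ed) sep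

  -- Ladder sets towards two targets.

  ladder-mono : ∀ {x y w} → I x w y → ∀ e → Ladder x y e → Ladder x w e
  ladder-mono i e l@(ed , _ , inc) = ladder ed (Sep-extend ed i (Ladder-Sep l)) inc

  -- As x⁺ does not pass y, it lies in I(x,y), so every class crossed on the way to x⁺ separates x
  -- from y. With `ladder-mono` the two ladder sets agree and the next milestone is shared.
  next-within : ∀ {x y w x⁺} → I x w y → AntiBasisOf x (Ladder x w) x⁺ → I x⁺ w y →
                ∀ e → Ladder x w e → Ladder x y e
  next-within {x} {y} {w} i a j e l@(ed , _ , inc) = ladder ed
    (Sep-extend ed (I-inner (ladder-next-I a) j) (to (anti⇔Sep (Ladder-IsClassSet x w) a ed) l)) inc

  -- Extension of the milestones by the hypercube of L.

  module Extension {v w : V} {L : ClassSet} (cs : IsClassSet L) (out : OutgoingFrom v L)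
                   (nonempty : Σ Pair L) (aw : AntiBasisOf v L w) where

    L⇔Sep : ∀ {e} → IsEdge e → L e ⇔ Sep e v w
    L⇔Sep = anti⇔Sep cs aw

    L-incident : ∀ {e} → L e → Incident e v
    L-incident Le with z , vz , _ , θ ← out _ Le = z , vz , θ

    L-edge : ∀ {e} → L e → IsEdge e
    L-edge = proj₁ cs _

    v∈I : I v0 w v
    v∈I = anti-I aw

    v∈I-from : ∀ {x} → I v0 v x → I x w v
    v∈I-from = I-innerˡ v∈I

    L-same : ∀ {e x} → I x w v → L e → Same e v x
    L-same {e} {x} i Le with same? e v x
    ... | yes s = s
    ... | no s = contradiction (I⇒Same (L-edge Le) i s) (to (L⇔Sep (L-edge Le)) Le)

    w∉I : ∀ {x} → I x w v → x ≢ w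
    w∉I i refl = let _ , Le = nonempty in to (L⇔Sep (L-edge Le)) Le (L-same i Le)

    -- The classes of L are those separating v from w, and all have an edge at v, so the ladder set
    -- of (v,w) is L.
    next-v : AntiBasisOf v (Ladder v w) w
    next-v = anti-resp (λ e Le → ladder (L-edge Le) (to (L⇔Sep (L-edge Le)) Le) (L-incident Le))
                       (λ e l → from (L⇔Sep (proj₁ l)) (Ladder-Sep l)) aw

    module _ {p : V} (v-ladder : AntiBasisOf p (Ladder p v) v) (i : I p w v) where

      v-incident : ∀ {f} → IsEdge f → Sep f p v → Incident f p
      v-incident fd sep = proj₂ (proj₂ (from (anti⇔Sep (Ladder-IsClassSet p v) v-ladder fd) sep))

      -- All the classes have an edge at p. Two of them span a square there because v, or w once e
      -- is involved, lies across both.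
      incident⇒POF : ∀ {e} (S : ClassSet) → (∀ f → S f → IsEdge f × Sep f p v) →
                     L e → Incident e p → POF (λ f → S f ⊎ Θ f e)
      incident⇒POF {e} S S⇒Sep Le inc f g = orth
        where
        Sep-e : Sep e p w
        Sep-e q = to (L⇔Sep (L-edge Le)) Le (trans (L-same i Le) q)
        Sep-Θe : ∀ {f} → Θ f e → Sep f p w
        Sep-Θe θ = Sep-Θ (Θ-sym θ) (L-edge Le) Sep-e
        orth : S f ⊎ Θ f e → S g ⊎ Θ g e → ¬ Θ f g → Orth f g
        orth (inj₁ sf) (inj₁ sg) ¬Θ with fd , sepf ← S⇒Sep f sf | gd , sepg ← S⇒Sep g sg =
          incident⇒Orth (v-incident fd sepf) (v-incident gd sepg) ¬Θ sepf sepg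
        orth (inj₁ sf) (inj₂ θ) ¬Θ with fd , sepf ← S⇒Sep f sf =
          incident⇒Orth (v-incident fd sepf) (Incident-Θ (Θ-sym θ) inc) ¬Θ (Sep-extend fd i sepf) (Sep-Θe θ)
        orth (inj₂ θ) (inj₁ sg) ¬Θ with gd , sepg ← S⇒Sep g sg =
          incident⇒Orth (Incident-Θ (Θ-sym θ) inc) (v-incident gd sepg) ¬Θ (Sep-Θe θ) (Sep-extend gd i sepg)
        orth (inj₂ θ) (inj₂ θ′) ¬Θ = contradiction (θ ◅◅ Θ-sym θ′) ¬Θ

      -- Descend a geodesic from v to p: a square carries the incidence of e over each of its edges.
      POF⇒incident : ∀ {e} (S : ClassSet) → (∀ f → IsEdge f → Sep f p v → S f) →
                     L e → POF (λ f → S f ⊎ Θ f e) → Incident e p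
      POF⇒incident {e} S Sep⇒S Le pof = descend (d v p) refl I-right (L-incident Le)
        where
        descend : ∀ n {q} → d q p ≡ n → I p v q → Incident e q → Incident e p
        descend zero eq _ inc rewrite d≡0⇒≡ eq = inc
        descend (suc n) {q} eq pvq (z , qz , θ)
          with r , qr , er ← step-towards {q} {p} (λ { refl → 0≢1+n (trans (sym (d-refl q)) eq) })
          -- The class of qr separates p from v while e does not, so the two are distinct and the
          -- POF makes them orthogonal.
          with sepf ← Sep-extend qr pvq (towards⇒Sep qr er ∘ sym)
          with ¬Θ ← (λ s → Sep-Θ s qr sepf (sym (L-same i Le)))
          with t , sepf-t , sepe-t ← Orth⇒opposite (pof _ e (inj₁ (Sep⇒S _ qr sepf)) (inj₂ ε) ¬Θ) q
          with m , (_ , rm , mz , zq , q≢m , r≢z) ← square-at qr ε qz θ ¬Θ sepf-t sepe-t =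
          descend n (suc-injective (trans (sym er) eq))
            (I-sym (I-trans (I-sym pvq) (trans (cong (_+ d r p) (~⇒d≡1 qr)) (sym er))))
            (m , rm , (inj₁ (inj₁ (rm , mz , zq , qr , r≢z , q≢m ∘ sym)) ◅ θ))

    -- As long as v is ahead, `next-within` gives the sequences towards v and w the same next
    -- milestone. They reach p together, and there too the ladder sets agree.
    Pen-ladder : ∀ {x p e} → I x w v → x ≢ v → Pen x w v → Pen x v p → Ladder p w e → Sep e p v
    Pen-ladder i x≢v (last _ _) _ _ = contradiction refl x≢v
    Pen-ladder i x≢v (later a _ pen) (last _ _) l = Ladder-Sep (next-within i a (Pen-I pen) _ l)
    Pen-ladder i x≢v (later a _ pen) (later a′ x⁺≢v pen′) l
      with refl ← ladder-next-unique (anti-resp (next-within i a (Pen-I pen)) (ladder-mono i) a) a′ =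
      Pen-ladder (Pen-I pen) x⁺≢v pen pen′ l

    -- Both sequences advance through the same milestones until v.
    Pen⇒Milestones : ∀ {x ms₁ ms₂} → I x w v → x ≢ v → Pen x w v → Milestones x w ms₁ → Milestones x v ms₂ →
                     ∀ z → z ∈ ms₁ ⇔ (z ∈ ms₂ ⊎ z ≡ w)
    Pen⇒Milestones i x≢v (last _ _) _ _ z = contradiction refl x≢v
    Pen⇒Milestones i x≢v (later a ne _) (done _ a′) _ z = contradiction (ladder-next-unique a a′) ne
    Pen⇒Milestones i x≢v (later a _ pen) (step _ a₁ _ m₁) m₂ z
      with refl ← ladder-next-unique a a₁
      with a′ ← anti-resp (next-within i a (Pen-I pen)) (ladder-mono i) a
      with m₂
    ... | step _ a₂ x⁺≢v m₂′ with refl ← ladder-next-unique a′ a₂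
      with ih ← Pen⇒Milestones (Pen-I pen) x⁺≢v pen m₁ m₂′ z = mk⇔
        (λ { (here eq) → inj₁ (here eq) ; (there z∈) → map₁ there (to ih z∈) })
        (λ { (inj₁ (here eq)) → here eq
           ; (inj₁ (there z∈)) → there (from ih (inj₁ z∈))
           ; (inj₂ eq) → there (from ih (inj₂ eq)) })
    -- The sequence towards v ends with x⁺ = v; by `next-v` the other one goes from v to w in a
    -- single step.
    Pen⇒Milestones i x≢v (later a _ pen) (step _ a₁ _ m₁) m₂ z | done _ a₂
      with refl ← ladder-next-unique a′ a₂ with m₁
    ... | step _ a₃ ne _ = contradiction (ladder-next-unique a₃ next-v) ne
    ... | done _ _ = mk⇔
        (λ { (here eq) → inj₁ (here eq)
           ; (there (here eq)) → inj₁ (there (here eq))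
           ; (there (there (here eq))) → inj₂ eq })
        (λ { (inj₁ (here eq)) → here eq
           ; (inj₁ (there (here eq))) → there (here eq)
           ; (inj₂ eq) → there (there (here eq)) })

    module _ {u p : V} (u∈I : I v0 v u) (u≢v : u ≢ v) {ms : List V} (m : Milestones u v ms)
             (pen : Pen u v p) where

      p∈I : I p w v
      p∈I = I-innerˡ (v∈I-from u∈I) (Pen-I pen)

      -- A class with an edge at a milestone x that separates x from w but not from v belongs to L.
      -- Having edges at x and v, it has one at p by `boundary-convex`, and `incident⇒POF`
      -- contradicts the assumption. So the ladder sets agree all the way to v.
      nonorthogonal⇒Pen : (∀ e → L e → ¬ POF (λ f → LBar u v f ⊎ Θ f e)) → Pen u w v
      nonorthogonal⇒Pen ¬pof = climb u∈I pen
        where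
        ladder-bound : ∀ {x} → I v0 v x → I x v p → ∀ e → Ladder x w e → Ladder x v e
        ladder-bound {x} i j e l@(ed , _ , inc) with same? e x v
        ... | no sep = ladder ed sep inc
        ... | yes same = contradiction
              (incident⇒POF (Pen-anti pen) p∈I (LBar u v) (λ f → LBar⇒Sep u≢v pen) Le
                (boundary-convex ed inc (L-incident Le) same j))
              (¬pof e Le)
          where
          Le : L e
          Le = from (L⇔Sep ed) (Ladder-Sep l ∘ trans same)
        climb : ∀ {x} → I v0 v x → Pen x v p → Pen x w v
        climb i q@(last _ a) = later (anti-resp (ladder-mono (v∈I-from i)) (ladder-bound i (Pen-I q)) a)
          (w∉I I-left) (last v∈I next-v)
        climb i q@(later a _ q′) =
          later (anti-resp (ladder-mono (v∈I-from i)) (ladder-bound i (Pen-I q)) a)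
                (w∉I (v∈I-from i′)) (climb i′ q′)
          where i′ = I-trans i (ladder-next-I a)

      -- A POF would give e an edge at p and put e in the ladder set of (p,w). By `Pen-ladder` it
      -- would separate p from v, against `L-same`.
      Pen⇒nonorthogonal : Pen u w v → ∀ e → L e → ¬ POF (λ f → LBar u v f ⊎ Θ f e)
      Pen⇒nonorthogonal pen′ e Le pof = Pen-ladder (v∈I-from u∈I) u≢v pen′ pen
        (ladder (L-edge Le) (λ q → to (L⇔Sep (L-edge Le)) Le (trans (L-same p∈I Le) q))
          (POF⇒incident (Pen-anti pen) p∈I (LBar u v) (λ f → Sep⇒LBar u≢v m pen) Le pof))
        (sym (L-same p∈I Le))

    -- By hypothesis v is a milestone of (u,w). A penultimate milestone q nearer to w would be a
    -- milestone of (u,v), hence in I(u,v) and no nearer to w than v.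
    Milestones⇒Pen-v : ∀ {u ms₁ ms₂} → I v0 v u → Milestones u w ms₁ → Milestones u v ms₂ →
                       (∀ z → z ∈ ms₁ ⇔ (z ∈ ms₂ ⊎ z ≡ w)) → Pen u w v
    Milestones⇒Pen-v {u} i m₁ m₂ h with q , pen ← Milestones⇒Pen m₁
      with Pen-closest m₁ pen (from (h v) (inj₁ (last-milestone m₂))) (w∉I I-left)
    ... | inj₁ refl = pen
    ... | inj₂ lt = case to (h q) (Pen∈ m₁ pen) of λ
        { (inj₁ q∈) → contradiction (I⇒≤ʳ (I-innerˡ (v∈I-from i) (Milestones-I m₂ q∈))) (<⇒≱ lt)
        ; (inj₂ q≡w) → contradiction q≡w (Pen≢ (w∉I (v∈I-from i)) pen) }

theorem8 : (G : MedianGraph) (v0 : MedianGraph.V G) →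
    let open Theory G v0 in
    (u v : V) → I v0 v u → u ≢ v →
    (L : ClassSet) → IsClassSet L → POF L → OutgoingFrom v L → Σ Pair L →
    (w : V) → AntiBasisOf v L w →
    let
      cond-i = ∀ p → Penultimate u w p → p ≡ v
      cond-ii = ∀ ms₁ ms₂ → Milestones u w ms₁ → Milestones u v ms₂ →
                  ∀ z → (z ∈ ms₁ ⇔ (z ∈ ms₂ ⊎ z ≡ w))
      cond-iii = ∀ e → L e → ¬ POF (λ f → LBar u v f ⊎ Θ f e)
    in (cond-i ⇔ cond-ii) × (cond-ii ⇔ cond-iii)
-- Each condition is compared with `Pen u w v`. The existence of milestone lists keeps (i) and (ii),
-- which quantify over all such lists, from holding vacuously.
theorem8 G v0 u v u∈I u≢v L cs _ out nonempty w aw =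
  mk⇔ (λ i → Pen⇒ii (i⇒Pen i)) (λ ii → Pen⇒i (ii⇒Pen ii)) ,
  mk⇔ (λ ii → Pen⇒nonorthogonal u∈I u≢v m₂ pen (ii⇒Pen ii))
      (λ iii → Pen⇒ii (nonorthogonal⇒Pen u∈I u≢v m₂ pen iii))
  where
  open Theory G v0
  open MedianTheory G v0
  open Extension cs out nonempty aw
  v∈uw : I u w v
  v∈uw = v∈I-from u∈I
  u≢w : u ≢ w
  u≢w = w∉I v∈uw
  Πuw : Σ (List V) (Milestones u w)
  Πuw = milestones-exist (d u w) ≤-refl (I-sym (I-trans (I-sym v∈I) (I-sym u∈I)))
  Πuv : Σ (List V) (Milestones u v)
  Πuv = milestones-exist (d u v) ≤-refl u∈I
  m₁ = proj₂ Πuw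
  m₂ = proj₂ Πuv
  pen = proj₂ (Milestones⇒Pen m₂)
  i⇒Pen : (∀ p → Penultimate u w p → p ≡ v) → Pen u w v
  i⇒Pen i with p , pen′ ← Milestones⇒Pen m₁ with refl ← i p (Pen⇒Penultimate u≢w m₁ pen′) = pen′
  Pen⇒i : Pen u w v → ∀ p → Penultimate u w p → p ≡ v
  Pen⇒i pen′ p pu = Pen-unique (Penultimate⇒Pen u≢w pu) pen′
  Pen⇒ii : Pen u w v → ∀ ms₁ ms₂ → Milestones u w ms₁ → Milestones u v ms₂ →
           ∀ z → z ∈ ms₁ ⇔ (z ∈ ms₂ ⊎ z ≡ w)
  Pen⇒ii pen′ _ _ = Pen⇒Milestones v∈uw u≢v pen′
  ii⇒Pen : (∀ ms₁ ms₂ → Milestones u w ms₁ → Milestones u v ms₂ → ∀ z → z ∈ ms₁ ⇔ (z ∈ ms₂ ⊎ z ≡ w)) →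
           Pen u w v
  ii⇒Pen ii = Milestones⇒Pen-v u∈I m₁ m₂ (ii _ _ m₁ m₂)
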